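{- For each $m\in\mathbb{N}$, finding the asymptotic density $$\mu\!\left(\frac{\mathcal{R}_m}{\mathcal{C}_{\mathbf{S}\mathbf{K}}}\right)=\lim_{n\to\infty}\frac{|\{P\in\mathcal{R}_m:|P|=n\}|}{|\{P\in\mathcal{C}_{\mathbf{S}\mathbf{K}}:|P|=n\}|}$$ of combinators normalising in $m$ (normal-order reduction) steps in the set of all $\mathbf{S}\mathbf{K}$-combinators is computable; that is, there is an algorithm which, given $m$, computes this real number (given $m$ and $j\in\mathbb{N}$, it outputs a rational number within $2^{ -j}$ of it).
   Context: $\mathcal{C}_{\mathbf{S}\mathbf{K}}$ is the set of $\mathbf{S}\mathbf{K}$-combinators: the terms built from the primitive combinators $\mathbf{S},\mathbf{K}$ by binary application (associating to the left). The size $|P|$ of a combinator is its number of applications. Reduction rules: $\mathbf{S}N_1N_2N_3\to N_1N_3(N_2N_3)$ and $\mathbf{K}N_1N_2\to N_1$, applied to any subterm. A term is in normal form if no rule applies. Normal-order reduction always contracts the leftmost outermost redex. $\mathcal{R}_m$ is the set of $\mathbf{S}\mathbf{K}$-combinators whose normal-order reduction reaches a normal form in exactly $m$ steps. -}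

module Defs where

open import Data.Empty using (⊥-elim)
open import Data.Integer.Base using (+_)
open import Data.List.Base using (List; []; _∷_; length; filter; cartesianProductWith)
open import Data.List.Membership.Propositional using (_∈_)
open import Data.List.Membership.Propositional.Properties
  using (∈-cartesianProductWith⁺; ∈-cartesianProductWith⁻; ∈-filter⁺; ∈-filter⁻)
open import Data.List.Relation.Unary.All as All using (All; []; _∷_)
open import Data.List.Relation.Unary.AllPairs using ([]; _∷_)
open import Data.List.Relation.Unary.Any using (here; there)
open import Data.List.Relation.Unary.Unique.Propositional using (Unique)
import Data.List.Relation.Unary.Unique.Propositional.Properties as Unique
open import Data.Nat.Base as ℕ using (ℕ; zero; suc; NonZero; s≤s)
import Data.Nat.Properties as ℕ
open import Data.Product.Base using (∃; ∃-syntax; _×_; _,_; proj₂)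
open import Data.Rational.Base using (ℚ; _/_; _+_; _-_; _≤_; ∣_∣)
open import Data.Sum.Base using (_⊎_; inj₁; inj₂)
open import Function.Bundles using (_⇔_; mk⇔; module Equivalence)
open import Level using (0ℓ)
open import Relation.Binary.PropositionalEquality using (_≡_; _≢_; refl; cong; subst)
open import Relation.Nullary using (¬_; Dec; yes; no)
open import Relation.Nullary.Decidable using (map′)
open import Relation.Unary using (Pred; Decidable)

------------------------------------------------------------------------
-- Combinators and reduction

infixl 9 _·_
infix 4 _▷_ _⟶_ _⇒_

data Term : Set where
  S K : Term
  _·_ : Term → Term → Term

size : Term → ℕ
size S       = 0
size K       = 0
size (t · u) = suc (size t ℕ.+ size u)

-- The reduction rules, at the root only.
data _▷_ : Term → Term → Set where
  S-rule : ∀ {x y z} → S · x · y · z ▷ x · z · (y · z)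
  K-rule : ∀ {x y} → K · x · y ▷ x

-- The reduction rules, applied to any subterm.
data _⟶_ : Term → Term → Set where
  root  : ∀ {t u} → t ▷ u → t ⟶ u
  left  : ∀ {t t′ u} → t ⟶ t′ → t · u ⟶ t′ · u
  right : ∀ {t u u′} → u ⟶ u′ → t · u ⟶ t · u′

Redex : Pred Term 0ℓ
Redex t = ∃[ u ] t ▷ u

NormalForm : Pred Term 0ℓ
NormalForm t = ∀ u → ¬ (t ⟶ u)

-- Normal-order reduction: the side conditions make the contracted redex
-- the leftmost among the outermost ones.
data _⇒_ : Term → Term → Set where
  root  : ∀ {t u} → t ▷ u → t ⇒ u
  left  : ∀ {t t′ u} → ¬ Redex (t · u) → t ⇒ t′ → t · u ⇒ t′ · u
  right : ∀ {t u u′} → ¬ Redex (t · u) → NormalForm t → u ⇒ u′ → t · u ⇒ t · u′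

-- NormalisesIn m is the class 𝓡ₘ.
data NormalisesIn : ℕ → Pred Term 0ℓ where
  done : ∀ {t} → NormalForm t → NormalisesIn zero t
  step : ∀ {m t u} → t ⇒ u → NormalisesIn m u → NormalisesIn (suc m) t

redex? : Decidable Redex
redex? S                     = no λ ()
redex? K                     = no λ ()
redex? (S · _)               = no λ ()
redex? (K · _)               = no λ ()
redex? (S · _ · _)           = no λ ()
redex? (K · _ · _)           = yes (_ , K-rule)
redex? (S · _ · _ · _)       = yes (_ , S-rule)
redex? (K · _ · _ · _)       = no λ ()
redex? (_ · _ · _ · _ · _)   = no λ ()

⇒⊆⟶ : ∀ {t u} → t ⇒ u → t ⟶ u
⇒⊆⟶ (root r)      = root r
⇒⊆⟶ (left _ s)    = left (⇒⊆⟶ s)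
⇒⊆⟶ (right _ _ s) = right (⇒⊆⟶ s)

▷-deterministic : ∀ {t u v} → t ▷ u → t ▷ v → u ≡ v
▷-deterministic S-rule S-rule = refl
▷-deterministic K-rule K-rule = refl

⇒-deterministic : ∀ {t u v} → t ⇒ u → t ⇒ v → u ≡ v
⇒-deterministic (root r)       (root r′)        = ▷-deterministic r r′
⇒-deterministic (root r)       (left ¬r _)      = ⊥-elim (¬r (_ , r))
⇒-deterministic (root r)       (right ¬r _ _)   = ⊥-elim (¬r (_ , r))
⇒-deterministic (left ¬r _)    (root r)         = ⊥-elim (¬r (_ , r))
⇒-deterministic (left _ s)     (left _ s′)      = cong (_· _) (⇒-deterministic s s′)
⇒-deterministic (left _ s)     (right _ nf _)   = ⊥-elim (nf _ (⇒⊆⟶ s))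
⇒-deterministic (right ¬r _ _) (root r)         = ⊥-elim (¬r (_ , r))
⇒-deterministic (right _ nf _) (left _ s)       = ⊥-elim (nf _ (⇒⊆⟶ s))
⇒-deterministic (right _ _ s)  (right _ _ s′)   = cong (_ ·_) (⇒-deterministic s s′)

progress : ∀ t → NormalForm t ⊎ ∃[ u ] t ⇒ u
progress S = inj₁ λ { _ (root ()) }
progress K = inj₁ λ { _ (root ()) }
progress (t · u) with redex? (t · u)
... | yes (_ , r) = inj₂ (_ , root r)
... | no ¬r with progress t
...   | inj₂ (_ , s) = inj₂ (_ , left ¬r s)
...   | inj₁ nf-t with progress u
...     | inj₂ (_ , s) = inj₂ (_ , right ¬r nf-t s)
...     | inj₁ nf-u = inj₁ λ { _ (root r)  → ¬r (_ , r)
                             ; _ (left s)  → nf-t _ s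
                             ; _ (right s) → nf-u _ s }

normalisesIn? : ∀ m → Decidable (NormalisesIn m)
normalisesIn? zero t with progress t
... | inj₁ nf      = yes (done nf)
... | inj₂ (_ , s) = no λ { (done nf) → nf _ (⇒⊆⟶ s) }
normalisesIn? (suc m) t with progress t
... | inj₁ nf      = no λ { (step s _) → nf _ (⇒⊆⟶ s) }
... | inj₂ (u , s) =
  map′ (step s)
       (λ { (step s′ n) → subst (NormalisesIn m) (⇒-deterministic s′ s) n })
       (normalisesIn? m u)

------------------------------------------------------------------------
-- Counting combinators by size

byDepth : ℕ → List Term
byDepth zero    = S ∷ K ∷ []
byDepth (suc d) = S ∷ K ∷ cartesianProductWith _·_ (byDepth d) (byDepth d)

-- A combinator of size n has depth at most n; ∈-combinators and
-- combinators-unique say that each one is listed exactly once.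
combinators : ℕ → List Term
combinators n = filter (λ t → size t ℕ.≟ n) (byDepth n)

byDepth-complete : ∀ {d} t → size t ℕ.≤ d → t ∈ byDepth d
byDepth-complete {zero}  S _ = here refl
byDepth-complete {suc _} S _ = here refl
byDepth-complete {zero}  K _ = there (here refl)
byDepth-complete {suc _} K _ = there (here refl)
byDepth-complete (t · u) (s≤s le) = there (there (∈-cartesianProductWith⁺ _·_
  (byDepth-complete t (ℕ.≤-trans (ℕ.m≤m+n _ _) le))
  (byDepth-complete u (ℕ.≤-trans (ℕ.m≤n+m _ (size t)) le))))

byDepth-unique : ∀ d → Unique (byDepth d)
byDepth-unique zero    = ((λ ()) ∷ []) ∷ [] ∷ []
byDepth-unique (suc d) =
  ((λ ()) ∷ All.tabulate (apart λ ())) ∷ All.tabulate (apart λ ()) ∷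
  Unique.cartesianProductWith⁺ _·_ (λ { refl → refl , refl })
    (byDepth-unique d) (byDepth-unique d)
  where
  apart : ∀ {a} → (∀ {t u} → a ≢ t · u) →
          ∀ {v} → v ∈ cartesianProductWith _·_ (byDepth d) (byDepth d) → a ≢ v
  apart a≢ v∈ with ∈-cartesianProductWith⁻ _·_ (byDepth d) (byDepth d) v∈
  ... | _ , _ , _ , _ , refl = a≢

∈-combinators : ∀ {n t} → t ∈ combinators n ⇔ size t ≡ n
∈-combinators {n} {t} = mk⇔
  (λ t∈ → proj₂ (∈-filter⁻ (λ t → size t ℕ.≟ n) {xs = byDepth n} t∈))
  (λ eq → ∈-filter⁺ (λ t → size t ℕ.≟ n)
            (byDepth-complete t (ℕ.≤-reflexive eq)) eq)

combinators-unique : ∀ n → Unique (combinators n)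
combinators-unique n = Unique.filter⁺ (λ t → size t ℕ.≟ n) (byDepth-unique n)

combinators-nonZero : ∀ n → NonZero (length (combinators n))
combinators-nonZero n = nonempty (Equivalence.from ∈-combinators (size-comb n))
  where
  comb : ℕ → Term
  comb zero    = K
  comb (suc k) = K · comb k

  size-comb : ∀ k → size (comb k) ≡ k
  size-comb zero    = refl
  size-comb (suc k) = cong suc (size-comb k)

  nonempty : ∀ {t : Term} {xs} → t ∈ xs → NonZero (length xs)
  nonempty (here _)  = _
  nonempty (there _) = _

proportion : {A : Pred Term 0ℓ} → Decidable A → ℕ → ℚ
proportion A? n = + length (filter A? (combinators n)) / length (combinators n)
  where instance _ = combinators-nonZero n

------------------------------------------------------------------------
-- Real numbers, as regular Cauchy sequences of rationals

2^- : ℕ → ℚ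
2^- j = + 1 / (2 ℕ.^ j)
  where instance _ = ℕ.m^n≢0 2 j

record ℝ : Set where
  field
    approx  : ℕ → ℚ
    regular : ∀ i j → ∣ approx i - approx j ∣ ≤ 2^- i + 2^- j

infix 4 ∣_-_∣≤_ _ConvergesTo_

-- The real number ∣ q - x ∣ is at most r.  By regularity, approx x k is
-- within 2⁻ᵏ of x.
∣_-_∣≤_ : ℚ → ℝ → ℚ → Set
∣ q - x ∣≤ r = ∀ k → ∣ q - ℝ.approx x k ∣ ≤ r + 2^- k

_ConvergesTo_ : (ℕ → ℚ) → ℝ → Set
a ConvergesTo x = ∀ j → ∃[ N ] (∀ n → N ℕ.≤ n → ∣ a n - x ∣≤ 2^- j)

HasDensity : {A : Pred Term 0ℓ} → Decidable A → ℝ → Set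
HasDensity A? x = proportion A? ConvergesTo x

{-# OPTIONS --safe #-}

-- Choose p so that p · t needs more than m head reductions whatever t is.
-- Then replacing t in p · t, anywhere inside a term, does not affect membership
-- in 𝓡ₘ.
--
-- Let f be a [0,1]-valued function on terms that does not see such replacements,
-- and let E n f be its mean over the combinators of size n.  Splitting a large
-- term at its root gives, up to a small error,
--   E (n+1) f  ≈  Σ_u 8^-(|u|+1) (E (n-|u|) f(u · _) + E (n-|u|) f(_ · u)),
-- the sum being over finitely many u, with coefficients adding up to nearly 1.
-- The functions on the right are of the same kind, and f(p · _) is constant; so a
-- bound e on the eventual oscillation of the means, valid for all such f, improves
-- by a fixed fraction.  Hence the means form a Cauchy sequence with an explicit
-- modulus.
--
-- Both the error and the coefficients are controlled by the recurrence
-- (n+2) cₙ₊₁ = (8n+4) cₙ for the number cₙ of combinators of size n.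
module Submission where

open import Defs
open import Data.Integer.Base as ℤ using () renaming (+_ to pos)
import Data.Integer.Properties as ℤ
open import Data.Bool.Base using (true; false; if_then_else_)
open import Data.List.Base using (List; []; _∷_; _++_; length; filter; concat; map; applyUpTo; cartesianProductWith)
open import Data.List.Membership.Propositional using (_∈_)
open import Data.List.Membership.Propositional.Properties
open import Data.List.Membership.Propositional.Properties.WithK using (unique∧set⇒bag)
import Data.List.Relation.Unary.All.Properties as All
import Data.List.Relation.Unary.AllPairs.Properties as AllPairs
open import Data.List.Relation.Unary.Any using (here; there)
open import Data.List.Relation.Unary.Unique.Propositional using (Unique)
import Data.List.Relation.Unary.Unique.Propositional.Properties as Unique
open import Data.List.Relation.Binary.BagAndSetEquality using (∼bag⇒↭)
open import Data.List.Relation.Binary.Permutation.Propositional as ↭ using (_↭_)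
open import Data.Nat.Base as ℕ using (ℕ; zero; suc; _∸_; NonZero; s≤s; z≤n)
import Data.Nat.Properties as ℕ
open import Data.Product.Base using (Σ-syntax; _×_; _,_; ∃; ∃-syntax; -,_; proj₁; proj₂)
open import Data.Rational.Base using (ℚ; mkℚ; _/_; _+_; _*_; _-_; -_; _≤_; _<_; ∣_∣; 0ℚ; 1ℚ; ½; toℚᵘ; nonNegative; positive; *<*)
open import Data.Rational.Properties
open import Data.Rational.Solver
open import Data.Rational.Unnormalised.Base as ℚᵘ using (mkℚᵘ; *≡*)
import Data.Rational.Unnormalised.Properties as ℚᵘ
open import Data.Sum.Base using (_⊎_; inj₁; inj₂)
open import Data.Empty using (⊥-elim)
open import Function.Base using (_∘_; flip)
open import Function.Bundles using (mk⇔; module Equivalence)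
open import Relation.Binary.PropositionalEquality
open import Relation.Nullary using (¬_; does; yes; no)
open import Relation.Unary using (Pred; Decidable)
open import Level using (0ℓ)
open +-*-Solver using (solve; con; _:+_; _:*_; _:-_; _:=_; :-_)

-- Invariance of 𝓡ₘ

infix 4 _≈[_]_ _~[_]_

data _~[_]_ : Term → Term → Term → Set where
  ~-refl : ∀ {p t} → t ~[ p ] t
  ~-app  : ∀ {p t t′ u u′} → t ~[ p ] t′ → u ~[ p ] u′ → t · u ~[ p ] t′ · u′
  ~-hide : ∀ {p t u} → p · t ~[ p ] p · u

-- At least k head reductions start from t, also when t is applied to further arguments.
data Persists : ℕ → Term → Set where
  now   : ∀ {t} → Persists zero t
  later : ∀ {k t u} → Persists k t → Persists (suc k) (K · t · u)
  app   : ∀ {k t u} → Persists k t → Persists k (t · u)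

persists-pred : ∀ {k t} → Persists (suc k) t → Persists k t
persists-pred {zero}  _         = now
persists-pred {suc k} (later p) = later (persists-pred p)
persists-pred {suc k} (app p)   = app (persists-pred p)

-- A root redex `t · u` needs `t` to be `K · x` or `S · x · y`, and neither of these persists for a
-- positive number of steps.
persists-head : ∀ {k t u} → Persists (suc k) t → ¬ Redex (t · u)
persists-head (app (app ())) (_ , S-rule)

persists-step : ∀ {k t} → Persists (suc k) t → ∃[ u ] (t ⇒ u × Persists k u)
persists-step (later p) = -, root K-rule , p
persists-step (app p) with persists-step p
... | _ , s , q = -, left (persists-head p) s , app q

-- Normal-order reduction needs at least k steps to tell the two terms apart.
data _≈[_]_ : Term → ℕ → Term → Set where
  ≈-refl    : ∀ {k t} → t ≈[ k ] t
  ≈-app     : ∀ {k t t′ u u′} → t ≈[ k ] t′ → u ≈[ k ] u′ → t · u ≈[ k ] t′ · u′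
  ≈-persist : ∀ {k t u} → Persists k t → Persists k u → t ≈[ k ] u

≈-sym : ∀ {k t u} → t ≈[ k ] u → u ≈[ k ] t
≈-sym ≈-refl          = ≈-refl
≈-sym (≈-app e e′)    = ≈-app (≈-sym e) (≈-sym e′)
≈-sym (≈-persist p q) = ≈-persist q p

≈-pred : ∀ {k t u} → t ≈[ suc k ] u → t ≈[ k ] u
≈-pred ≈-refl          = ≈-refl
≈-pred (≈-app e e′)    = ≈-app (≈-pred e) (≈-pred e′)
≈-pred (≈-persist p q) = ≈-persist (persists-pred p) (persists-pred q)

-- The positive index rules out `≈-persist` along the spine of the redex, so the related term has a
-- redex of the same rule at its root. The index is lowered to agree with `≈-simulation`.
≈-contract : ∀ {k t t′ u u′ v} → t ≈[ suc k ] t′ → u ≈[ suc k ] u′ → t · u ▷ v →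
             ∃[ v′ ] (t′ · u′ ▷ v′ × v ≈[ k ] v′)
≈-contract ≈-refl e S-rule =
  -, S-rule , ≈-app (≈-app ≈-refl (≈-pred e)) (≈-app ≈-refl (≈-pred e))
≈-contract (≈-app ≈-refl ey) e S-rule =
  -, S-rule , ≈-app (≈-app ≈-refl (≈-pred e)) (≈-app (≈-pred ey) (≈-pred e))
≈-contract (≈-app (≈-app ≈-refl ex) ey) e S-rule =
  -, S-rule , ≈-app (≈-app (≈-pred ex) (≈-pred e)) (≈-app (≈-pred ey) (≈-pred e))
≈-contract (≈-app (≈-app (≈-persist () _) _) _) _ S-rule
≈-contract (≈-app (≈-persist (app ()) _) _) _ S-rule
≈-contract (≈-persist (app (app ())) _) _ S-rule
≈-contract ≈-refl e K-rule = -, K-rule , ≈-refl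
≈-contract (≈-app ≈-refl ex) e K-rule = -, K-rule , ≈-pred ex

≈-¬Redex : ∀ {k t t′ u u′} → t ≈[ suc k ] t′ → u ≈[ suc k ] u′ →
           ¬ Redex (t · u) → ¬ Redex (t′ · u′)
≈-¬Redex e e′ ¬r (_ , r) with ≈-contract (≈-sym e) (≈-sym e′) r
... | _ , r′ , _ = ¬r (_ , r′)

·-normal : ∀ {t u} → ¬ Redex (t · u) → NormalForm t → NormalForm u → NormalForm (t · u)
·-normal ¬r nt nu _ (root r)  = ¬r (_ , r)
·-normal ¬r nt nu _ (left s)  = nt _ s
·-normal ¬r nt nu _ (right s) = nu _ s

-- The two reductions run in lockstep: either they contract redexes at corresponding positions, or
-- they have reached a persisting pair, where each side makes its own head step at the cost of one
-- unit of index.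
≈-simulation : ∀ {k t t′} → t ≈[ suc k ] t′ →
               (NormalForm t × NormalForm t′) ⊎
               ∃[ u ] ∃[ u′ ] (t ⇒ u × t′ ⇒ u′ × u ≈[ k ] u′)
≈-simulation {t = t} ≈-refl with progress t
... | inj₁ nf      = inj₁ (nf , nf)
... | inj₂ (_ , s) = inj₂ (-, -, s , s , ≈-refl)
≈-simulation (≈-persist p q) with persists-step p | persists-step q
... | _ , s , p′ | _ , s′ , q′ = inj₂ (-, -, s , s′ , ≈-persist p′ q′)
≈-simulation (≈-app {t = t} {u = u} e e′) with redex? (t · u)
... | yes (_ , r) with ≈-contract e e′ r
...   | _ , r′ , e″ = inj₂ (-, -, root r , root r′ , e″)
≈-simulation (≈-app e e′) | no ¬r with ≈-¬Redex e e′ ¬r | ≈-simulation e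
... | ¬r′ | inj₂ (_ , _ , s , s′ , e″) =
  inj₂ (-, -, left ¬r s , left ¬r′ s′ , ≈-app e″ (≈-pred e′))
... | ¬r′ | inj₁ (nt , nt′) with ≈-simulation e′
...   | inj₂ (_ , _ , s , s′ , e″) =
  inj₂ (-, -, right ¬r nt s , right ¬r′ nt′ s′ , ≈-app (≈-pred e) e″)
...   | inj₁ (nu , nu′) = inj₁ (·-normal ¬r nt nu , ·-normal ¬r′ nt′ nu′)

-- Each of the `m` steps uses one unit of index. One more must remain at the end, because index zero
-- relates a normal form to every term.
normalisesIn-resp-≈ : ∀ {m t u} → t ≈[ suc m ] u → NormalisesIn m t → NormalisesIn m u
normalisesIn-resp-≈ e n with ≈-simulation e
normalisesIn-resp-≈ e (done _)   | inj₁ (_ , nu) = done nu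
normalisesIn-resp-≈ e (step s _) | inj₁ (nt , _) = ⊥-elim (nt _ (⇒⊆⟶ s))
normalisesIn-resp-≈ e (done nt)  | inj₂ (_ , _ , s , _) = ⊥-elim (nt _ (⇒⊆⟶ s))
normalisesIn-resp-≈ e (step s n) | inj₂ (_ , _ , s′ , s″ , e′)
  rewrite ⇒-deterministic s s′ = step s″ (normalisesIn-resp-≈ e′ n)

-- The term `p` of the overview: nested `K`-redexes, each of which uncovers the next when it is
-- contracted.
delay : ℕ → Term
delay zero    = K
delay (suc k) = K · delay k · K

delay-persists : ∀ k → Persists k (delay k)
delay-persists zero    = now
delay-persists (suc k) = later (delay-persists k)

~⇒≈ : ∀ {k t u} → t ~[ delay k ] u → t ≈[ k ] u
~⇒≈ ~-refl       = ≈-refl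
~⇒≈ (~-app e e′) = ≈-app (~⇒≈ e) (~⇒≈ e′)
~⇒≈ ~-hide       = ≈-persist (app (delay-persists _)) (app (delay-persists _))

~-sym : ∀ {p t u} → t ~[ p ] u → u ~[ p ] t
~-sym ~-refl       = ~-refl
~-sym (~-app e e′) = ~-app (~-sym e) (~-sym e′)
~-sym ~-hide       = ~-hide

-- Rational arithmetic

*-monoˡ : ∀ {r p q} → 0ℚ ≤ r → p ≤ q → r * p ≤ r * q
*-monoˡ {r} 0≤r = *-monoˡ-≤-nonNeg r {{nonNegative 0≤r}}

*-monoʳ : ∀ {r p q} → 0ℚ ≤ r → p ≤ q → p * r ≤ q * r
*-monoʳ {r} 0≤r = *-monoʳ-≤-nonNeg r {{nonNegative 0≤r}}

*-nonNeg : ∀ {p q} → 0ℚ ≤ p → 0ℚ ≤ q → 0ℚ ≤ p * q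
*-nonNeg {p} 0≤p 0≤q = subst (_≤ p * _) (*-zeroʳ p) (*-monoˡ 0≤p 0≤q)

+-nonNeg : ∀ {p q} → 0ℚ ≤ p → 0ℚ ≤ q → 0ℚ ≤ p + q
+-nonNeg 0≤p 0≤q = +-mono-≤ 0≤p 0≤q

p≤p+q : ∀ {p q} → 0ℚ ≤ q → p ≤ p + q
p≤p+q {p} 0≤q = subst (_≤ p + _) (+-identityʳ p) (+-monoʳ-≤ p 0≤q)

+-cancelʳ-≤ : ∀ {p q} r → p + r ≤ q + r → p ≤ q
+-cancelʳ-≤ {p} {q} r le = subst₂ _≤_ (eq p r) (eq q r) (+-monoˡ-≤ (- r) le)
  where
  eq : ∀ x y → x + y + - y ≡ x
  eq = solve 2 (λ x y → x :+ y :+ :- y := x) refl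

∣p-q∣≤ : ∀ {p q e} → p ≤ q + e → q ≤ p + e → ∣ p - q ∣ ≤ e
∣p-q∣≤ {p} {q} {e} le ge with ∣p∣≡p∨∣p∣≡-p (p - q)
... | inj₁ eq = subst (_≤ e) (sym eq)
      (+-cancelʳ-≤ q (subst₂ _≤_ (solve 2 (λ p q → p := p :- q :+ q) refl p q) (+-comm q e) le))
... | inj₂ eq = subst (_≤ e) (sym eq)
      (+-cancelʳ-≤ p (subst₂ _≤_ (solve 2 (λ p q → q := :- (p :- q) :+ p) refl p q) (+-comm p e) ge))

-- The embedding of ℕ in ℚ, by recursion so that `ι (suc n)` unfolds to a polynomial in `ι n` for
-- the ring solver.
ι : ℕ → ℚ
ι zero    = 0ℚ
ι (suc n) = 1ℚ + ι n

0≤1 : 0ℚ ≤ 1ℚ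
0≤1 = nonNegative⁻¹ 1ℚ

ι-nonNeg : ∀ n → 0ℚ ≤ ι n
ι-nonNeg zero    = ≤-refl
ι-nonNeg (suc n) = +-nonNeg 0≤1 (ι-nonNeg n)

ι-pos : ∀ n → 0ℚ < ι (suc n)
ι-pos n = +-mono-<-≤ (positive⁻¹ 1ℚ) (ι-nonNeg n)

ι-+ : ∀ m n → ι (m ℕ.+ n) ≡ ι m + ι n
ι-+ zero    n = sym (+-identityˡ (ι n))
ι-+ (suc m) n = trans (cong (1ℚ +_) (ι-+ m n)) (sym (+-assoc 1ℚ (ι m) (ι n)))

ι-* : ∀ m n → ι (m ℕ.* n) ≡ ι m * ι n
ι-* zero    n = sym (*-zeroˡ (ι n))
ι-* (suc m) n = trans (ι-+ n (m ℕ.* n)) (trans (cong (ι n +_) (ι-* m n))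
  (solve 2 (λ x y → y :+ x :* y := (con 1ℚ :+ x) :* y) refl (ι m) (ι n)))

/-suc : ∀ a b → pos (suc a) / suc b ≡ pos 1 / suc b + pos a / suc b
/-suc a b = toℚᵘ-injective (ℚᵘ.≃-trans (toℚᵘ-fromℚᵘ (mkℚᵘ (pos (suc a)) b))
  (ℚᵘ.≃-sym (ℚᵘ.≃-trans (toℚᵘ-homo-+ (pos 1 / suc b) (pos a / suc b))
    (ℚᵘ.≃-trans (ℚᵘ.+-cong (toℚᵘ-fromℚᵘ (mkℚᵘ (pos 1) b)) (toℚᵘ-fromℚᵘ (mkℚᵘ (pos a) b)))
      (*≡* (trans (cong (ℤ._* pos (suc b)) (sym (ℤ.*-distribʳ-+ (pos (suc b)) (pos 1) (pos a))))
                  (ℤ.*-assoc (pos (suc a)) (pos (suc b)) (pos (suc b)))))))))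

/-ι : ∀ a b .{{_ : NonZero b}} → pos a / b ≡ ι a * (pos 1 / b)
/-ι zero    (suc b) = trans (0/n≡0 (suc b)) (sym (*-zeroˡ (pos 1 / suc b)))
/-ι (suc a) (suc b) = trans (/-suc a b) (trans (cong (pos 1 / suc b +_) (/-ι a (suc b)))
  (solve 2 (λ x y → y :+ x :* y := (con 1ℚ :+ x) :* y) refl (ι a) (pos 1 / suc b)))

n/n≡1 : ∀ n .{{_ : NonZero n}} → pos n / n ≡ 1ℚ
n/n≡1 (suc n) = toℚᵘ-injective (ℚᵘ.≃-trans (toℚᵘ-fromℚᵘ (mkℚᵘ (pos (suc n)) n))
  (*≡* (ℤ.*-comm (pos (suc n)) (pos 1))))

ι*1/n≡1 : ∀ n .{{_ : NonZero n}} → ι n * (pos 1 / n) ≡ 1ℚ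
ι*1/n≡1 n = trans (sym (/-ι n n)) (n/n≡1 n)

-- The denominator of `p` is a witness, its product with `p` being the numerator.
archimedean : ∀ {p} → 0ℚ < p → ∃[ n ] 1ℚ ≤ ι n * p
archimedean {mkℚ (pos zero)  d c} (*<* (ℤ.+<+ ()))
archimedean {p@(mkℚ (pos (suc a)) d c)} _ = suc d , subst (1ℚ ≤_) eq (p≤p+q (ι-nonNeg a))
  where
  u = pos 1 / suc d
  eq : ι (suc a) ≡ ι (suc d) * p
  eq = begin
    ι (suc a)                     ≡⟨ sym (*-identityʳ (ι (suc a))) ⟩
    ι (suc a) * 1ℚ                ≡⟨ cong (ι (suc a) *_) (sym (ι*1/n≡1 (suc d))) ⟩
    ι (suc a) * (ι (suc d) * u)   ≡⟨ solve 3 (λ x y z → x :* (y :* z) := y :* (x :* z)) refl (ι (suc a)) (ι (suc d)) u ⟩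
    ι (suc d) * (ι (suc a) * u)   ≡⟨ cong (ι (suc d) *_) (sym (/-ι (suc a) (suc d))) ⟩
    ι (suc d) * (pos (suc a) / suc d) ≡⟨ cong (ι (suc d) *_) (↥p/↧p≡p p) ⟩
    ι (suc d) * p                 ∎
    where open ≡-Reasoning
archimedean {mkℚ ℤ.-[1+ _ ] d c} (*<* ())

1/n-pos : ∀ n .{{_ : NonZero n}} → 0ℚ < pos 1 / n
1/n-pos n@(suc _) = positive⁻¹ (pos 1 / n) {{normalize-pos 1 n}}

-- Finite sums

variable
  A B : Set

Σ : List A → (A → ℚ) → ℚ
Σ []       f = 0ℚ
Σ (x ∷ xs) f = f x + Σ xs f

Σ-cong : ∀ (xs : List A) {f g : A → ℚ} → (∀ x → x ∈ xs → f x ≡ g x) → Σ xs f ≡ Σ xs g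
Σ-cong []       eq = refl
Σ-cong (x ∷ xs) eq = cong₂ _+_ (eq x (here refl)) (Σ-cong xs (λ y → eq y ∘ there))

Σ-mono : ∀ (xs : List A) {f g : A → ℚ} → (∀ x → x ∈ xs → f x ≤ g x) → Σ xs f ≤ Σ xs g
Σ-mono []       le = ≤-refl
Σ-mono (x ∷ xs) le = +-mono-≤ (le x (here refl)) (Σ-mono xs (λ y → le y ∘ there))

-- A surplus at a single index survives in the sum. It carries the gain at the summand `p` over to
-- the whole weighted sum.
Σ-mono-gap : ∀ (xs : List A) {f g : A → ℚ} {x d} → (∀ x → x ∈ xs → f x ≤ g x) →
             x ∈ xs → f x + d ≤ g x → Σ xs f + d ≤ Σ xs g
Σ-mono-gap (x ∷ xs) {f} {g} {d = d} le (here refl) gap =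
  subst (_≤ Σ (x ∷ xs) g) (solve 3 (λ x y d → x :+ d :+ y := x :+ y :+ d) refl (f x) (Σ xs f) d)
    (+-mono-≤ gap (Σ-mono xs (λ y → le y ∘ there)))
Σ-mono-gap (x ∷ xs) {f} {g} {d = d} le (there x∈) gap =
  subst (_≤ Σ (x ∷ xs) g) (sym (+-assoc (f x) (Σ xs f) d))
    (+-mono-≤ (le x (here refl)) (Σ-mono-gap xs (λ y → le y ∘ there) x∈ gap))

Σ-nonNeg : ∀ (xs : List A) {f : A → ℚ} → (∀ x → 0ℚ ≤ f x) → 0ℚ ≤ Σ xs f
Σ-nonNeg []       le = ≤-refl
Σ-nonNeg (x ∷ xs) le = +-nonNeg (le x) (Σ-nonNeg xs le)

Σ-+ : ∀ (xs : List A) (f g : A → ℚ) → Σ xs (λ x → f x + g x) ≡ Σ xs f + Σ xs g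
Σ-+ []       f g = refl
Σ-+ (x ∷ xs) f g = trans (cong (f x + g x +_) (Σ-+ xs f g))
  (solve 4 (λ a b c d → a :+ b :+ (c :+ d) := a :+ c :+ (b :+ d)) refl (f x) (g x) (Σ xs f) (Σ xs g))

Σ-*ˡ : ∀ (xs : List A) c (f : A → ℚ) → Σ xs (λ x → c * f x) ≡ c * Σ xs f
Σ-*ˡ []       c f = sym (*-zeroʳ c)
Σ-*ˡ (x ∷ xs) c f = trans (cong (c * f x +_) (Σ-*ˡ xs c f)) (sym (*-distribˡ-+ c (f x) (Σ xs f)))

Σ-*ʳ : ∀ (xs : List A) c (f : A → ℚ) → Σ xs (λ x → f x * c) ≡ Σ xs f * c
Σ-*ʳ xs c f = trans (Σ-cong xs (λ x _ → *-comm (f x) c)) (trans (Σ-*ˡ xs c f) (*-comm c (Σ xs f)))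

Σ-++ : ∀ (xs ys : List A) (f : A → ℚ) → Σ (xs ++ ys) f ≡ Σ xs f + Σ ys f
Σ-++ []       ys f = sym (+-identityˡ (Σ ys f))
Σ-++ (x ∷ xs) ys f = trans (cong (f x +_) (Σ-++ xs ys f)) (sym (+-assoc (f x) (Σ xs f) (Σ ys f)))

Σ-map : ∀ (h : A → B) xs (f : B → ℚ) → Σ (map h xs) f ≡ Σ xs (f ∘ h)
Σ-map h []       f = refl
Σ-map h (x ∷ xs) f = cong (f (h x) +_) (Σ-map h xs f)

Σ-swap : ∀ (xs : List A) (ys : List B) (f : A → B → ℚ) →
         Σ xs (λ x → Σ ys (f x)) ≡ Σ ys (λ y → Σ xs (λ x → f x y))
Σ-swap xs []       f = trans (Σ-*ˡ xs 0ℚ (λ _ → 0ℚ)) (*-zeroˡ (Σ xs (λ _ → 0ℚ)))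
Σ-swap xs (y ∷ ys) f = trans (Σ-+ xs (λ x → f x y) (λ x → Σ ys (f x)))
  (cong (Σ xs (λ x → f x y) +_) (Σ-swap xs ys f))

Σ-product : ∀ {C : Set} (h : A → B → C) xs ys (f : C → ℚ) →
            Σ (cartesianProductWith h xs ys) f ≡ Σ xs (λ x → Σ ys (λ y → f (h x y)))
Σ-product h []       ys f = refl
Σ-product h (x ∷ xs) ys f = trans (Σ-++ (map (h x) ys) _ f)
  (cong₂ _+_ (Σ-map (h x) ys f) (Σ-product h xs ys f))

Σ-↭ : ∀ {xs ys : List A} → xs ↭ ys → (f : A → ℚ) → Σ xs f ≡ Σ ys f
Σ-↭ ↭.refl         f = refl
Σ-↭ (↭.prep x p)   f = cong (f x +_) (Σ-↭ p f)
Σ-↭ (↭.swap {ys = ys} x y p) f = trans (cong (λ s → f x + (f y + s)) (Σ-↭ p f))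
  (solve 3 (λ a b c → a :+ (b :+ c) := b :+ (a :+ c)) refl (f x) (f y) (Σ ys f))
Σ-↭ (↭.trans p q)  f = trans (Σ-↭ p f) (Σ-↭ q f)

Σ-length : ∀ (xs : List A) → Σ xs (λ _ → 1ℚ) ≡ ι (length xs)
Σ-length []       = refl
Σ-length (_ ∷ xs) = cong (1ℚ +_) (Σ-length xs)

sumTo : ℕ → (ℕ → ℚ) → ℚ
sumTo zero    h = 0ℚ
sumTo (suc n) h = h 0 + sumTo n (h ∘ suc)

sumTo-cong : ∀ n {g h : ℕ → ℚ} → (∀ k → k ℕ.< n → g k ≡ h k) → sumTo n g ≡ sumTo n h
sumTo-cong zero    eq = refl
sumTo-cong (suc n) eq = cong₂ _+_ (eq 0 (s≤s z≤n)) (sumTo-cong n (λ k lt → eq (suc k) (s≤s lt)))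

sumTo-last : ∀ n h → sumTo (suc n) h ≡ sumTo n h + h n
sumTo-last zero    h = +-comm (h 0) 0ℚ
sumTo-last (suc n) h = trans (cong (h 0 +_) (sumTo-last n (h ∘ suc)))
  (sym (+-assoc (h 0) (sumTo n (h ∘ suc)) (h (suc n))))

Σ-concat : ∀ n (xss : ℕ → List A) (f : A → ℚ) →
           Σ (concat (applyUpTo xss n)) f ≡ sumTo n (λ k → Σ (xss k) f)
Σ-concat zero    xss f = refl
Σ-concat (suc n) xss f = trans (Σ-++ (xss 0) _ f) (cong (Σ (xss 0) f +_) (Σ-concat n (xss ∘ suc) f))

-- Sums over antidiagonals

conv : (ℕ → ℕ → ℚ) → ℕ → ℚ
conv g n = sumTo (suc n) (λ k → g k (n ∸ k))

conv-cong : ∀ {g h} n → (∀ k l → k ℕ.+ l ≡ n → g k l ≡ h k l) → conv g n ≡ conv h n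
conv-cong zero    eq = cong (_+ 0ℚ) (eq 0 0 refl)
conv-cong (suc n) eq = cong₂ _+_ (eq 0 (suc n) refl) (conv-cong n (λ k l e → eq (suc k) l (cong suc e)))

conv-last : ∀ g n → conv g (suc n) ≡ conv (λ k l → g k (suc l)) n + g (suc n) 0
conv-last g zero    = solve 2 (λ a b → a :+ (b :+ con 0ℚ) := a :+ con 0ℚ :+ b) refl (g 0 1) (g 1 0)
conv-last g (suc n) = trans (cong (g 0 (suc (suc n)) +_) (conv-last (g ∘ suc) n))
  (sym (+-assoc (g 0 (suc (suc n))) (conv (λ k l → g (suc k) (suc l)) n) (g (suc (suc n)) 0)))

conv-flip : ∀ g n → conv (flip g) n ≡ conv g n
conv-flip g zero    = refl
conv-flip g (suc n) = trans (conv-last (flip g) n)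
  (trans (cong (_+ g 0 (suc n)) (conv-flip (g ∘ suc) n)) (+-comm _ (g 0 (suc n))))

conv-+ : ∀ g h n → conv (λ k l → g k l + h k l) n ≡ conv g n + conv h n
conv-+ g h zero    = solve 2 (λ a b → a :+ b :+ con 0ℚ := a :+ con 0ℚ :+ (b :+ con 0ℚ)) refl (g 0 0) (h 0 0)
conv-+ g h (suc n) = trans (cong (g 0 (suc n) + h 0 (suc n) +_) (conv-+ (g ∘ suc) (h ∘ suc) n))
  (solve 4 (λ a b c d → a :+ b :+ (c :+ d) := a :+ c :+ (b :+ d)) refl
    (g 0 (suc n)) (h 0 (suc n)) (conv (g ∘ suc) n) (conv (h ∘ suc) n))

conv-*ˡ : ∀ c g n → conv (λ k l → c * g k l) n ≡ c * conv g n
conv-*ˡ c g zero    = solve 2 (λ c a → c :* a :+ con 0ℚ := c :* (a :+ con 0ℚ)) refl c (g 0 0)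
conv-*ˡ c g (suc n) = trans (cong (c * g 0 (suc n) +_) (conv-*ˡ c (g ∘ suc) n))
  (sym (*-distribˡ-+ c (g 0 (suc n)) (conv (g ∘ suc) n)))

conv-nonNeg : ∀ {g} n → (∀ k l → 0ℚ ≤ g k l) → 0ℚ ≤ conv g n
conv-nonNeg zero    0≤g = +-nonNeg (0≤g 0 0) ≤-refl
conv-nonNeg (suc n) 0≤g = +-nonNeg (0≤g 0 (suc n)) (conv-nonNeg n (λ k → 0≤g (suc k)))

-- As `M + M ≤ n`, the first `M` and the last `M` summands do not overlap, and the others are
-- nonnegative. The induction removes one summand at each end.
conv-ends : ∀ {g} → (∀ k l → 0ℚ ≤ g k l) → ∀ M n → M ℕ.+ M ℕ.≤ n →
            sumTo M (λ k → g k (n ∸ k) + g (n ∸ k) k) ≤ conv g n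
conv-ends 0≤g zero n _ = conv-nonNeg n 0≤g
conv-ends {g} 0≤g (suc M) (suc n) (s≤s le) rewrite ℕ.+-suc M M with n | le
... | suc m | s≤s le′ = begin
  first + last + sumTo M (λ k → g (suc k) (suc m ∸ k) + g (suc m ∸ k) (suc k))
    ≡⟨ cong (first + last +_) (sumTo-cong M (λ k k<M →
         cong (λ l → g (suc k) l + g l (suc k)) (ℕ.+-∸-assoc 1 (k≤m k<M)))) ⟩
  first + last + sumTo M (λ k → inner k (m ∸ k) + inner (m ∸ k) k)
    ≤⟨ +-monoʳ-≤ (first + last) (conv-ends (λ k l → 0≤g (suc k) (suc l)) M m le′) ⟩
  first + last + conv inner m
    ≡⟨ solve 3 (λ a b c → a :+ b :+ c := a :+ (c :+ b)) refl first last (conv inner m) ⟩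
  first + (conv inner m + last)
    ≡⟨ cong (first +_) (sym (conv-last (g ∘ suc) m)) ⟩
  conv g (suc (suc m)) ∎
  where
  open ≤-Reasoning
  first = g 0 (suc (suc m))
  last  = g (suc (suc m)) 0
  inner = λ k l → g (suc k) (suc l)
  k≤m : ∀ {k} → k ℕ.< M → k ℕ.≤ m
  k≤m k<M = ℕ.≤-trans (ℕ.<⇒≤ k<M) (ℕ.≤-trans (ℕ.m≤m+n M M) le′)

-- Counting combinators

layer : ℕ → ℕ → List Term
layer n k = cartesianProductWith _·_ (combinators k) (combinators (n ∸ k))

products : ℕ → List Term
products n = concat (applyUpTo (layer n) (suc n))

combinators-size : ∀ n {t} → t ∈ combinators n → size t ≡ n
combinators-size n = Equivalence.to (∈-combinators {n})

size-combinators : ∀ t → t ∈ combinators (size t)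
size-combinators t = Equivalence.from ∈-combinators refl

∈-products⁺ : ∀ n t → size t ≡ suc n → t ∈ products n
∈-products⁺ n (t · u) refl = ∈-concat⁺′
  (∈-cartesianProductWith⁺ _·_ (size-combinators t)
    (Equivalence.from (∈-combinators {size t ℕ.+ size u ∸ size t}) (sym (ℕ.m+n∸m≡n (size t) (size u)))))
  (∈-applyUpTo⁺ (layer n) (s≤s (ℕ.m≤m+n (size t) (size u))))

∈-products⁻ : ∀ n {t} → t ∈ products n → size t ≡ suc n
∈-products⁻ n t∈ with ∈-concat⁻′ (applyUpTo (layer n) (suc n)) t∈
... | _ , t∈′ , xs∈ with ∈-applyUpTo⁻ (layer n) xs∈
... | k , s≤s k≤n , refl with ∈-cartesianProductWith⁻ _·_ (combinators k) (combinators (n ∸ k)) t∈′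
... | _ , _ , u∈ , v∈ , refl = cong suc (trans
  (cong₂ ℕ._+_ (combinators-size k u∈) (combinators-size (n ∸ k) v∈)) (ℕ.m+[n∸m]≡n k≤n))

products-unique : ∀ n → Unique (products n)
products-unique n = Unique.concat⁺
  (All.applyUpTo⁺₂ (layer n) (suc n) (λ k → Unique.cartesianProductWith⁺ _·_ (λ { refl → refl , refl })
    (combinators-unique k) (combinators-unique (n ∸ k))))
  (AllPairs.applyUpTo⁺₁ (layer n) (suc n) (λ i<j _ → disjoint i<j))
  where
  disjoint : ∀ {i j} → i ℕ.< j → ∀ {t} →
    ¬ (t ∈ layer n i × t ∈ layer n j)
  disjoint {i} {j} i<j (t∈ , t∈′)
    with ∈-cartesianProductWith⁻ _·_ (combinators i) (combinators (n ∸ i)) t∈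
       | ∈-cartesianProductWith⁻ _·_ (combinators j) (combinators (n ∸ j)) t∈′
  ... | _ , _ , u∈ , _ , refl | _ , _ , u∈′ , _ , refl =
    ℕ.<⇒≢ i<j (trans (sym (combinators-size i u∈)) (combinators-size j u∈′))

-- Both lists are duplicate-free and have the same members. The permutation replaces the enumeration
-- by depth with one sorted by the size of the left factor, so that totals become convolutions.
combinators-suc : ∀ n → combinators (suc n) ↭ products n
combinators-suc n = ∼bag⇒↭ (unique∧set⇒bag (combinators-unique (suc n)) (products-unique n)
  (mk⇔ (λ t∈ → ∈-products⁺ n _ (combinators-size (suc n) t∈))
       (λ t∈ → Equivalence.from (∈-combinators {suc n}) (∈-products⁻ n t∈))))

total : ℕ → (Term → ℚ) → ℚ
total n = Σ (combinators n)

pairs : (Term → ℚ) → ℕ → ℕ → ℚ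
pairs f k l = Σ (combinators k) (λ u → total l (λ v → f (u · v)))

total-suc : ∀ n f → total (suc n) f ≡ conv (pairs f) n
total-suc n f = trans (Σ-↭ (combinators-suc n) f) (trans (Σ-concat (suc n) (layer n) f)
  (sumTo-cong (suc n) (λ k _ → Σ-product _·_ (combinators k) (combinators (n ∸ k)) f)))

-- The number cₙ of the overview, which is `2^(n+1)` times the n-th Catalan number.
γ : ℕ → ℚ
γ n = total n (λ _ → 1ℚ)

γ-suc : ∀ n → γ (suc n) ≡ conv (λ k l → γ k * γ l) n
γ-suc n = trans (total-suc n (λ _ → 1ℚ)) (conv-cong n (λ k l _ →
  trans (Σ-cong (combinators k) (λ _ _ → sym (*-identityˡ (γ l)))) (Σ-*ʳ (combinators k) (γ l) (λ _ → 1ℚ))))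

-- Adding the sum to its mirror image turns the weights of `(k, l)` and `(l, k)` into
-- `a * (k + l) + 2 * b`, which is constant on the antidiagonal.
conv-affine : ∀ a b (g : ℕ → ℕ → ℚ) n → (∀ k l → g k l ≡ g l k) →
              conv (λ k l → (a * ι k + b) * g k l) n + conv (λ k l → (a * ι k + b) * g k l) n ≡
              (a * ι n + (b + b)) * conv g n
conv-affine a b g n g-sym = begin
  conv h n + conv h n          ≡⟨ cong (conv h n +_) (sym (conv-flip h n)) ⟩
  conv h n + conv (flip h) n   ≡⟨ sym (conv-+ h (flip h) n) ⟩
  conv (λ k l → h k l + h l k) n ≡⟨ conv-cong n pointwise ⟩
  conv (λ k l → (a * ι n + (b + b)) * g k l) n ≡⟨ conv-*ˡ (a * ι n + (b + b)) g n ⟩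
  (a * ι n + (b + b)) * conv g n ∎
  where
  open ≡-Reasoning
  h : ℕ → ℕ → ℚ
  h k l = (a * ι k + b) * g k l
  pointwise : ∀ k l → k ℕ.+ l ≡ n → h k l + h l k ≡ (a * ι n + (b + b)) * g k l
  pointwise k l refl rewrite ι-+ k l | g-sym l k =
    solve 5 (λ a b x y z → (a :* x :+ b) :* z :+ (a :* y :+ b) :* z := (a :* (x :+ y) :+ (b :+ b)) :* z)
      refl a b (ι k) (ι l) (g k l)

2ℚ 4ℚ 8ℚ ⅛ : ℚ
2ℚ = pos 2 / 1
4ℚ = pos 4 / 1
8ℚ = pos 8 / 1
⅛  = pos 1 / 8

-- Sum (k+1) γₖ γₗ over k + l = m + 1: symmetry replaces k by its average, giving a multiple of
-- γₘ₊₂, while the recurrence at smaller indices reduces the terms with k > 0 to the sum for γₘ₊₁.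
γ-rec : ∀ n k → k ℕ.< n → (2ℚ + ι k) * γ (suc k) ≡ (8ℚ * ι k + 4ℚ) * γ k
γ-rec (suc n) zero    _ = refl
γ-rec (suc n) (suc m) (s≤s m<n) = begin
  (2ℚ + ι (suc m)) * γ (suc (suc m))
    ≡⟨ cong₂ _*_ (solve 1 (λ x → con 2ℚ :+ x := con 1ℚ :* x :+ (con 1ℚ :+ con 1ℚ)) refl (ι (suc m))) (γ-suc (suc m)) ⟩
  (1ℚ * ι (suc m) + (1ℚ + 1ℚ)) * conv g (suc m)
    ≡⟨ sym (conv-affine 1ℚ 1ℚ g (suc m) g-sym) ⟩
  conv h (suc m) + conv h (suc m)
    ≡⟨ cong (λ x → x + x) (cong (h 0 (suc m) +_) (conv-cong m shift)) ⟩
  (h 0 (suc m) + q) + (h 0 (suc m) + q)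
    -- The summand with `k = 0` is `2 * γ (suc m)`, since there are two combinators of size 0.
    ≡⟨ solve 2 (λ x q → con 1ℚ :* (con 2ℚ :* x) :+ q :+ (con 1ℚ :* (con 2ℚ :* x) :+ q) := con 4ℚ :* x :+ (q :+ q)) refl (γ (suc m)) q ⟩
  4ℚ * γ (suc m) + (q + q)
    ≡⟨ cong (4ℚ * γ (suc m) +_) (conv-affine 8ℚ 4ℚ g m g-sym) ⟩
  4ℚ * γ (suc m) + (8ℚ * ι m + (4ℚ + 4ℚ)) * conv g m
    ≡⟨ cong (λ x → 4ℚ * γ (suc m) + (8ℚ * ι m + (4ℚ + 4ℚ)) * x) (sym (γ-suc m)) ⟩
  4ℚ * γ (suc m) + (8ℚ * ι m + (4ℚ + 4ℚ)) * γ (suc m)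
    ≡⟨ solve 2 (λ x y → con 4ℚ :* y :+ (con 8ℚ :* x :+ (con 4ℚ :+ con 4ℚ)) :* y := (con 8ℚ :* (con 1ℚ :+ x) :+ con 4ℚ) :* y) refl (ι m) (γ (suc m)) ⟩
  (8ℚ * ι (suc m) + 4ℚ) * γ (suc m) ∎
  where
  open ≡-Reasoning
  g h h′ : ℕ → ℕ → ℚ
  g k l = γ k * γ l
  h k l = (1ℚ * ι k + 1ℚ) * g k l
  h′ k l = (8ℚ * ι k + 4ℚ) * g k l
  q : ℚ
  q = conv h′ m
  g-sym : ∀ k l → g k l ≡ g l k
  g-sym k l = *-comm (γ k) (γ l)
  shift : ∀ k l → k ℕ.+ l ≡ m → h (suc k) l ≡ h′ k l
  shift k l refl = trans
    (solve 3 (λ x y z → (con 1ℚ :* (con 1ℚ :+ x) :+ con 1ℚ) :* (y :* z) := (con 2ℚ :+ x) :* y :* z) refl (ι k) (γ (suc k)) (γ l))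
    -- The recurrence is used at every `k ≤ m`; the bound `n` makes this strong induction
    -- structural.
    (trans (cong (_* γ l) (γ-rec n k (ℕ.≤-<-trans (ℕ.m≤m+n k l) m<n))) (*-assoc (8ℚ * ι k + 4ℚ) (γ k) (γ l)))

-- Mean values over the combinators of a given size

inv : ℕ → ℚ
inv n = pos 1 / length (combinators n)
  where instance _ = combinators-nonZero n

inv-pos : ∀ n → 0ℚ < inv n
inv-pos n = 1/n-pos (length (combinators n))
  where instance _ = combinators-nonZero n

inv-nonNeg : ∀ n → 0ℚ ≤ inv n
inv-nonNeg n = <⇒≤ (inv-pos n)

γ*inv≡1 : ∀ n → γ n * inv n ≡ 1ℚ
γ*inv≡1 n = trans (cong (_* inv n) (Σ-length (combinators n))) (ι*1/n≡1 (length (combinators n)))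
  where instance _ = combinators-nonZero n

γ-nonNeg : ∀ n → 0ℚ ≤ γ n
γ-nonNeg n = Σ-nonNeg (combinators n) (λ _ → 0≤1)

γ-growth : ∀ n → γ (suc n) ≤ 8ℚ * γ n
γ-growth n = *-cancelˡ-≤-pos (2ℚ + ι n) {{positive (+-mono-<-≤ (positive⁻¹ 2ℚ) (ι-nonNeg n))}} (begin
  (2ℚ + ι n) * γ (suc n)      ≡⟨ γ-rec (suc n) n ℕ.≤-refl ⟩
  -- The added 12 is `8 * (n + 2) - (8 * n + 4)`.
  (8ℚ * ι n + 4ℚ) * γ n       ≤⟨ p≤p+q (*-nonNeg (nonNegative⁻¹ (pos 12 / 1)) (γ-nonNeg n)) ⟩
  (8ℚ * ι n + 4ℚ) * γ n + (pos 12 / 1) * γ n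
    ≡⟨ solve 2 (λ x y → (con 8ℚ :* x :+ con 4ℚ) :* y :+ con (pos 12 / 1) :* y := (con 2ℚ :+ x) :* (con 8ℚ :* y)) refl (ι n) (γ n) ⟩
  (2ℚ + ι n) * (8ℚ * γ n)     ∎)
  where open ≤-Reasoning

8^- : ℕ → ℚ
8^- zero    = 1ℚ
8^- (suc k) = ⅛ * 8^- k

8^-pos : ∀ k → 0ℚ < 8^- k
8^-pos zero    = positive⁻¹ 1ℚ
8^-pos (suc k) = positive⁻¹ _ {{pos*pos⇒pos ⅛ (8^- k) {{positive (8^-pos k)}}}}

8^-nonNeg : ∀ k → 0ℚ ≤ 8^- k
8^-nonNeg k = <⇒≤ (8^-pos k)

inv-suc : ∀ n → ⅛ * inv n ≤ inv (suc n)
inv-suc n = begin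
  ⅛ * x               ≡⟨ sym (*-identityʳ (⅛ * x)) ⟩
  ⅛ * x * 1ℚ          ≡⟨ cong (⅛ * x *_) (sym (γ*inv≡1 (suc n))) ⟩
  ⅛ * x * (γ (suc n) * y) ≤⟨ *-monoˡ (*-nonNeg (nonNegative⁻¹ ⅛) (inv-nonNeg n)) (*-monoʳ (inv-nonNeg (suc n)) (γ-growth n)) ⟩
  ⅛ * x * (8ℚ * γ n * y) ≡⟨ solve 3 (λ x y g → con ⅛ :* x :* (con 8ℚ :* g :* y) := g :* x :* y) refl x y (γ n) ⟩
  γ n * x * y         ≡⟨ cong (_* y) (γ*inv≡1 n) ⟩
  1ℚ * y              ≡⟨ *-identityˡ y ⟩
  y                   ∎
  where
  open ≤-Reasoning
  x = inv n
  y = inv (suc n)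

-- Each increase of the size by one multiplies the number of combinators by at most 8. This bounds
-- the coefficients of the root split from below.
inv-+ : ∀ j m → 8^- j * inv m ≤ inv (j ℕ.+ m)
inv-+ zero    m = ≤-reflexive (*-identityˡ (inv m))
inv-+ (suc j) m = ≤-trans (≤-reflexive (*-assoc ⅛ (8^- j) (inv m)))
  (≤-trans (*-monoˡ (nonNegative⁻¹ ⅛) (inv-+ j m)) (inv-suc (j ℕ.+ m)))

mean : ℕ → (Term → ℚ) → ℚ
mean n f = total n f * inv n

mean-mono : ∀ n {f g} → (∀ t → f t ≤ g t) → mean n f ≤ mean n g
mean-mono n le = *-monoʳ (inv-nonNeg n) (Σ-mono (combinators n) (λ t _ → le t))

mean-const : ∀ n c → mean n (λ _ → c) ≡ c
mean-const n c = begin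
  total n (λ _ → c) * inv n       ≡⟨ cong (_* inv n) (Σ-cong (combinators n) (λ _ _ → sym (*-identityʳ c))) ⟩
  total n (λ _ → c * 1ℚ) * inv n  ≡⟨ cong (_* inv n) (Σ-*ˡ (combinators n) c (λ _ → 1ℚ)) ⟩
  c * γ n * inv n                 ≡⟨ *-assoc c (γ n) (inv n) ⟩
  c * (γ n * inv n)               ≡⟨ cong (c *_) (γ*inv≡1 n) ⟩
  c * 1ℚ                          ≡⟨ *-identityʳ c ⟩
  c                               ∎
  where open ≡-Reasoning

mean-+ : ∀ n f g → mean n (λ t → f t + g t) ≡ mean n f + mean n g
mean-+ n f g = trans (cong (_* inv n) (Σ-+ (combinators n) f g)) (*-distribʳ-+ (inv n) (total n f) (total n g))

mean-cong : ∀ n {f g} → (∀ t → f t ≡ g t) → mean n f ≡ mean n g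
mean-cong n eq = cong (_* inv n) (Σ-cong (combinators n) (λ t _ → eq t))

mean-1- : ∀ n f → mean n (λ t → 1ℚ - f t) + mean n f ≡ 1ℚ
mean-1- n f = trans (sym (mean-+ n (λ t → 1ℚ - f t) f)) (trans (mean-cong n (λ t → eq (f t))) (mean-const n 1ℚ))
  where
  eq : ∀ x → 1ℚ - x + x ≡ 1ℚ
  eq = solve 1 (λ x → con 1ℚ :- x :+ x := con 1ℚ) refl

-- Splitting off small subterms at the root

small : ℕ → List Term
small M = concat (applyUpTo combinators M)

∈-small⁺ : ∀ {M} t → size t ℕ.< M → t ∈ small M
∈-small⁺ t lt = ∈-concat⁺′ (size-combinators t) (∈-applyUpTo⁺ combinators lt)

∈-small⁻ : ∀ M {t} → t ∈ small M → size t ℕ.< M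
∈-small⁻ M t∈ with ∈-concat⁻′ (applyUpTo combinators M) t∈
... | _ , t∈′ , xs∈ with ∈-applyUpTo⁻ combinators xs∈
... | k , k<M , refl = subst (ℕ._< M) (sym (combinators-size k t∈′)) k<M

total-ends : ∀ {f} → (∀ t → 0ℚ ≤ f t) → ∀ M n → M ℕ.+ M ℕ.≤ n →
  Σ (small M) (λ u → total (n ∸ size u) (λ v → f (u · v)) + total (n ∸ size u) (λ v → f (v · u))) ≤
  total (suc n) f
total-ends {f} 0≤f M n le = begin
  Σ (small M) (λ u → both (size u) u)        ≡⟨ Σ-concat M combinators (λ u → both (size u) u) ⟩
  sumTo M (λ k → Σ (combinators k) (λ u → both (size u) u))
    ≡⟨ sumTo-cong M (λ k _ → regroup k) ⟩
  sumTo M (λ k → pairs f k (n ∸ k) + pairs f (n ∸ k) k)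
    ≤⟨ conv-ends (λ k l → Σ-nonNeg (combinators k) (λ u → Σ-nonNeg (combinators l) (λ v → 0≤f (u · v)))) M n le ⟩
  conv (pairs f) n                           ≡⟨ sym (total-suc n f) ⟩
  total (suc n) f                            ∎
  where
  open ≤-Reasoning
  both : ℕ → Term → ℚ
  both k u = total (n ∸ k) (λ v → f (u · v)) + total (n ∸ k) (λ v → f (v · u))
  regroup : ∀ k → Σ (combinators k) (λ u → both (size u) u) ≡ pairs f k (n ∸ k) + pairs f (n ∸ k) k
  regroup k = trans
    (Σ-cong (combinators k) (λ u u∈ → cong (λ l → both l u) (combinators-size k u∈)))
    (trans (Σ-+ (combinators k) (λ u → total (n ∸ k) (λ v → f (u · v))) (λ u → total (n ∸ k) (λ v → f (v · u))))
      (cong (pairs f k (n ∸ k) +_) (Σ-swap (combinators k) (combinators (n ∸ k)) (λ u v → f (v · u)))))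

-- The limiting proportion of the combinators with left factor `u`, and likewise of those with right
-- factor `u`.
ω : Term → ℚ
ω u = 8^- (suc (size u))

ω-nonNeg : ∀ u → 0ℚ ≤ ω u
ω-nonNeg u = 8^-nonNeg (suc (size u))

sides : ℕ → (Term → ℚ) → Term → ℚ
sides n f u = mean (n ∸ size u) (λ v → f (u · v)) + mean (n ∸ size u) (λ v → f (v · u))

weighted : ℕ → ℕ → (Term → ℚ) → ℚ
weighted M n f = Σ (small M) (λ u → ω u * sides n f u)

-- The value of `weighted` at the constant function 1, with one unit for each side.
mass : ℕ → ℚ
mass M = Σ (small M) (λ u → ω u * (1ℚ + 1ℚ))

weighted-1- : ∀ M n f → weighted M n (λ t → 1ℚ - f t) + weighted M n f ≡ mass M
weighted-1- M n f = trans (sym (Σ-+ (small M) _ _)) (Σ-cong (small M) (λ u _ → eq u))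
  where
  eq : ∀ u → ω u * sides n (λ t → 1ℚ - f t) u + ω u * sides n f u ≡ ω u * (1ℚ + 1ℚ)
  eq u = trans
    (solve 5 (λ w a b c d → w :* (a :+ b) :+ w :* (c :+ d) := w :* (a :+ c :+ (b :+ d))) refl (ω u)
      (mean (n ∸ size u) (λ v → 1ℚ - f (u · v))) (mean (n ∸ size u) (λ v → 1ℚ - f (v · u)))
      (mean (n ∸ size u) (λ v → f (u · v))) (mean (n ∸ size u) (λ v → f (v · u))))
    (cong (ω u *_) (cong₂ _+_ (mean-1- (n ∸ size u) (λ v → f (u · v))) (mean-1- (n ∸ size u) (λ v → f (v · u)))))

-- Two changes lower the mean of a nonnegative function: dropping the terms with two large factors,
-- and replacing the exact coefficients by the smaller `ω u`.
weighted≤mean : ∀ {f} → (∀ t → 0ℚ ≤ f t) → ∀ M n → M ℕ.+ M ℕ.≤ n → weighted M n f ≤ mean (suc n) f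
weighted≤mean {f} 0≤f M n le = begin
  weighted M n f  ≤⟨ Σ-mono (small M) (λ u u∈ → bound u (size≤ u∈)) ⟩
  Σ (small M) (λ u → both u * inv (suc n)) ≡⟨ Σ-*ʳ (small M) (inv (suc n)) both ⟩
  Σ (small M) both * inv (suc n) ≤⟨ *-monoʳ (inv-nonNeg (suc n)) (total-ends 0≤f M n le) ⟩
  mean (suc n) f ∎
  where
  open ≤-Reasoning
  both : Term → ℚ
  both u = total (n ∸ size u) (λ v → f (u · v)) + total (n ∸ size u) (λ v → f (v · u))
  both-nonNeg : ∀ u → 0ℚ ≤ both u
  both-nonNeg u = +-nonNeg (Σ-nonNeg (combinators (n ∸ size u)) (λ v → 0≤f (u · v)))
                           (Σ-nonNeg (combinators (n ∸ size u)) (λ v → 0≤f (v · u)))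
  size≤ : ∀ {u} → u ∈ small M → size u ℕ.≤ n
  size≤ u∈ = ℕ.≤-trans (ℕ.<⇒≤ (∈-small⁻ M u∈)) (ℕ.≤-trans (ℕ.m≤m+n M M) le)
  bound : ∀ u → size u ℕ.≤ n → ω u * sides n f u ≤ both u * inv (suc n)
  bound u u≤n = begin
    ω u * sides n f u
      ≡⟨ solve 4 (λ w a b i → w :* (a :* i :+ b :* i) := (a :+ b) :* (w :* i)) refl (ω u)
           (total (n ∸ size u) (λ v → f (u · v))) (total (n ∸ size u) (λ v → f (v · u))) (inv (n ∸ size u)) ⟩
    both u * (ω u * inv (n ∸ size u))
      ≤⟨ *-monoˡ (both-nonNeg u) (inv-+ (suc (size u)) (n ∸ size u)) ⟩
    both u * inv (suc (size u ℕ.+ (n ∸ size u)))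
      ≡⟨ cong (λ k → both u * inv (suc k)) (ℕ.m+[n∸m]≡n u≤n) ⟩
    both u * inv (suc n) ∎

-- This is the lower bound weighted≤mean for 1 - f.
mean≤weighted : ∀ {f} → (∀ t → f t ≤ 1ℚ) → ∀ M n → M ℕ.+ M ℕ.≤ n →
                mean (suc n) f + mass M ≤ 1ℚ + weighted M n f
mean≤weighted {f} f≤1 M n le = begin
  mean (suc n) f + mass M ≡⟨ cong (mean (suc n) f +_) (sym (weighted-1- M n f)) ⟩
  mean (suc n) f + (weighted M n f̅ + weighted M n f)
    ≤⟨ +-monoʳ-≤ (mean (suc n) f) (+-monoˡ-≤ (weighted M n f) (weighted≤mean 0≤f̅ M n le)) ⟩
  mean (suc n) f + (mean (suc n) f̅ + weighted M n f)
    ≡⟨ solve 3 (λ a b c → a :+ (b :+ c) := b :+ a :+ c) refl (mean (suc n) f) (mean (suc n) f̅) (weighted M n f) ⟩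
  mean (suc n) f̅ + mean (suc n) f + weighted M n f ≡⟨ cong (_+ weighted M n f) (mean-1- (suc n) f) ⟩
  1ℚ + weighted M n f ∎
  where
  open ≤-Reasoning
  f̅ : Term → ℚ
  f̅ t = 1ℚ - f t
  0≤f̅ : ∀ t → 0ℚ ≤ f̅ t
  0≤f̅ t = +-cancelʳ-≤ (f t) (subst₂ _≤_ (sym (+-identityˡ (f t)))
    (solve 1 (λ x → con 1ℚ := con 1ℚ :- x :+ x) refl (f t)) (f≤1 t))

-- The mass of the small terms

-- A closed form for `1 - mass M`, equal to the central binomial coefficient `binom(2M, M)` divided
-- by `4^M`.
deficit : ℕ → ℚ
deficit M = ½ * ι (suc M) * γ M * 8^- M

deficit-suc : ∀ M → deficit (suc M) ≡ ½ * ⅛ * ((8ℚ * ι M + 4ℚ) * γ M) * 8^- M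
deficit-suc M = trans
  (solve 3 (λ x y z → con ½ :* (con 1ℚ :+ (con 1ℚ :+ x)) :* y :* (con ⅛ :* z) := con ½ :* con ⅛ :* ((con 2ℚ :+ x) :* y) :* z)
    refl (ι M) (γ (suc M)) (8^- M))
  (cong (λ x → ½ * ⅛ * x * 8^- M) (γ-rec (suc M) M ℕ.≤-refl))

mass≡sumTo : ∀ M → mass M ≡ sumTo M (λ k → γ k * (8^- (suc k) * (1ℚ + 1ℚ)))
mass≡sumTo M = trans (Σ-concat M combinators (λ u → ω u * (1ℚ + 1ℚ))) (sumTo-cong M (λ k _ →
  trans (Σ-cong (combinators k) (λ u u∈ → trans (cong (λ n → 8^- (suc n) * (1ℚ + 1ℚ)) (combinators-size k u∈))
    (sym (*-identityˡ (8^- (suc k) * (1ℚ + 1ℚ)))))) (Σ-*ʳ (combinators k) (8^- (suc k) * (1ℚ + 1ℚ)) (λ _ → 1ℚ))))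

-- The sum telescopes: by the recurrence for `γ`, the deficit loses at each `M` exactly the summand
-- that the mass gains.
mass+deficit : ∀ M → mass M + deficit M ≡ 1ℚ
mass+deficit M = trans (cong (_+ deficit M) (mass≡sumTo M)) (go M)
  where
  term : ℕ → ℚ
  term k = γ k * (8^- (suc k) * (1ℚ + 1ℚ))
  go : ∀ M → sumTo M term + deficit M ≡ 1ℚ
  go zero    = refl
  go (suc M) = begin
    sumTo (suc M) term + deficit (suc M) ≡⟨ cong₂ _+_ (sumTo-last M term) (deficit-suc M) ⟩
    sumTo M term + term M + ½ * ⅛ * ((8ℚ * ι M + 4ℚ) * γ M) * 8^- M
      ≡⟨ solve 4 (λ s x y z → s :+ y :* (con ⅛ :* z :* (con 1ℚ :+ con 1ℚ)) :+ con ½ :* con ⅛ :* ((con 8ℚ :* x :+ con 4ℚ) :* y) :* z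
           := s :+ con ½ :* (con 1ℚ :+ x) :* y :* z) refl (sumTo M term) (ι M) (γ M) (8^- M) ⟩
    sumTo M term + deficit M ≡⟨ go M ⟩
    1ℚ ∎
    where open ≡-Reasoning

deficit-nonNeg : ∀ M → 0ℚ ≤ deficit M
deficit-nonNeg M = *-nonNeg (*-nonNeg (*-nonNeg (nonNegative⁻¹ ½) (ι-nonNeg (suc M))) (γ-nonNeg M)) (8^-nonNeg M)

-- The classical bound `1/√(2M+1)`, stated without a root. Consecutive deficits have ratio
-- `(2M+1)/(2M+2)`, and `(2M+1)(2M+3)` is one less than `(2M+2)²`.
deficit-square : ∀ M → deficit M * deficit M * (2ℚ * ι M + 1ℚ) ≤ 1ℚ
deficit-square zero    = ≤-refl
deficit-square (suc M) = *-cancelʳ-≤-pos (e * e) {{pos*pos⇒pos e {{e-pos}} e {{e-pos}}}} (begin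
  d′ * d′ * (2ℚ * ι (suc M) + 1ℚ) * (e * e)
    ≡⟨ solve 3 (λ d x e → d :* d :* x :* (e :* e) := d :* e :* (d :* e) :* x) refl d′ (2ℚ * ι (suc M) + 1ℚ) e ⟩
  d′ * e * (d′ * e) * (2ℚ * ι (suc M) + 1ℚ)
    ≡⟨ cong (λ x → x * x * (2ℚ * ι (suc M) + 1ℚ)) ratio ⟩
  d * (2ℚ * x + 1ℚ) * (d * (2ℚ * x + 1ℚ)) * (2ℚ * ι (suc M) + 1ℚ)
    ≡⟨ solve 2 (λ d x → d :* (con 2ℚ :* x :+ con 1ℚ) :* (d :* (con 2ℚ :* x :+ con 1ℚ)) :* (con 2ℚ :* (con 1ℚ :+ x) :+ con 1ℚ)
         := d :* d :* (con 2ℚ :* x :+ con 1ℚ) :* ((con 2ℚ :* x :+ con 1ℚ) :* (con 2ℚ :* (con 1ℚ :+ x) :+ con 1ℚ))) refl d x ⟩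
  d * d * (2ℚ * x + 1ℚ) * ((2ℚ * x + 1ℚ) * (2ℚ * ι (suc M) + 1ℚ))
    ≤⟨ *-monoʳ (*-nonNeg (odd-nonNeg M) (odd-nonNeg (suc M))) (deficit-square M) ⟩
  1ℚ * ((2ℚ * x + 1ℚ) * (2ℚ * ι (suc M) + 1ℚ))
    ≤⟨ p≤p+q 0≤1 ⟩
  1ℚ * ((2ℚ * x + 1ℚ) * (2ℚ * ι (suc M) + 1ℚ)) + 1ℚ
    ≡⟨ solve 1 (λ x → con 1ℚ :* ((con 2ℚ :* x :+ con 1ℚ) :* (con 2ℚ :* (con 1ℚ :+ x) :+ con 1ℚ)) :+ con 1ℚ
         := con 1ℚ :* ((con 2ℚ :* (con 1ℚ :+ x)) :* (con 2ℚ :* (con 1ℚ :+ x)))) refl x ⟩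
  1ℚ * (e * e) ∎)
  where
  open ≤-Reasoning
  x = ι M
  d = deficit M
  d′ = deficit (suc M)
  e = 2ℚ * ι (suc M)
  e-pos = pos*pos⇒pos 2ℚ (ι (suc M)) {{positive (ι-pos M)}}
  odd-nonNeg : ∀ n → 0ℚ ≤ 2ℚ * ι n + 1ℚ
  odd-nonNeg n = +-nonNeg (*-nonNeg (nonNegative⁻¹ 2ℚ) (ι-nonNeg n)) 0≤1
  ratio : d′ * e ≡ d * (2ℚ * x + 1ℚ)
  ratio = trans (cong (_* e) (deficit-suc M))
    (solve 3 (λ x y z → con ½ :* con ⅛ :* ((con 8ℚ :* x :+ con 4ℚ) :* y) :* z :* (con 2ℚ :* (con 1ℚ :+ x))
      := con ½ :* (con 1ℚ :+ x) :* y :* z :* (con 2ℚ :* x :+ con 1ℚ)) refl x (γ M) (8^- M))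

-- If `δ < deficit M`, then `1 ≤ (nδ)² < (2M+1) * (deficit M)² ≤ 1`, where `n * δ ≥ 1` and `M > n²`.
-- The bound `k < M` later makes `p` one of the small terms.
deficit-small : ∀ {δ} → 0ℚ < δ → ∀ k → ∃[ M ] (k ℕ.< M × deficit M ≤ δ)
deficit-small {δ} 0<δ k with archimedean 0<δ
... | n , 1≤nδ = M , ℕ.m≤n+m (suc k) (n ℕ.* n) , ≮⇒≥ (λ δ<d → <-irrefl refl (absurd δ<d))
  where
  open ≤-Reasoning
  M = n ℕ.* n ℕ.+ suc k
  d = deficit M
  0≤δ = <⇒≤ 0<δ
  absurd : δ < d → 1ℚ < 1ℚ
  absurd δ<d = begin-strict
    1ℚ                     ≤⟨ 1≤nδ ⟩
    ι n * δ                ≡⟨ sym (*-identityʳ (ι n * δ)) ⟩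
    ι n * δ * 1ℚ           ≤⟨ *-monoˡ (*-nonNeg (ι-nonNeg n) 0≤δ) 1≤nδ ⟩
    ι n * δ * (ι n * δ)    ≡⟨ solve 2 (λ x y → x :* y :* (x :* y) := x :* x :* y :* y) refl (ι n) δ ⟩
    ι n * ι n * δ * δ      ≤⟨ *-monoˡ (*-nonNeg 0≤nn 0≤δ) (<⇒≤ δ<d) ⟩
    ι n * ι n * δ * d      ≤⟨ *-monoʳ (deficit-nonNeg M) (*-monoˡ 0≤nn (<⇒≤ δ<d)) ⟩
    ι n * ι n * d * d      ≡⟨ sym (+-identityʳ (ι n * ι n * d * d)) ⟩
    ι n * ι n * d * d + 0ℚ <⟨ +-monoʳ-< (ι n * ι n * d * d) 0<dd ⟩
    ι n * ι n * d * d + d * d ≤⟨ p≤p+q (*-nonNeg (<⇒≤ 0<dd) (+-nonNeg (ι-nonNeg M) (ι-nonNeg (suc k)))) ⟩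
    ι n * ι n * d * d + d * d + d * d * (ι M + ι (suc k)) ≡⟨ collapse ⟩
    d * d * (2ℚ * ι M + 1ℚ) ≤⟨ deficit-square M ⟩
    1ℚ                     ∎
    where
    0≤nn = *-nonNeg (ι-nonNeg n) (ι-nonNeg n)
    d-pos = positive (<-trans 0<δ δ<d)
    0<dd : 0ℚ < d * d
    0<dd = positive⁻¹ (d * d) {{pos*pos⇒pos d {{d-pos}} d {{d-pos}}}}
    ιM : ι M ≡ ι n * ι n + ι (suc k)
    ιM = trans (ι-+ (n ℕ.* n) (suc k)) (cong (_+ ι (suc k)) (ι-* n n))
    collapse : ι n * ι n * d * d + d * d + d * d * (ι M + ι (suc k)) ≡ d * d * (2ℚ * ι M + 1ℚ)
    collapse = subst (λ m → ι n * ι n * d * d + d * d + d * d * (m + ι (suc k)) ≡ d * d * (2ℚ * m + 1ℚ)) (sym ιM)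
      (solve 3 (λ x d s → x :* d :* d :+ d :* d :+ d :* d :* (x :+ s :+ s) := d :* d :* (con 2ℚ :* (x :+ s) :+ con 1ℚ))
        refl (ι n * ι n) d (ι (suc k)))

-- Oscillation of the means

record Invariant (p : Term) (f : Term → ℚ) : Set where
  field
    nonNeg   : ∀ t → 0ℚ ≤ f t
    ≤1       : ∀ t → f t ≤ 1ℚ
    respects : ∀ {t u} → t ~[ p ] u → f t ≡ f u

open Invariant

-- Fixing a root factor stays within the class, so an oscillation bound for all invariant functions
-- applies to both kinds of slice.
·-invariant : ∀ {p f} u → Invariant p f → Invariant p (λ v → f (u · v))
·-invariant u f-inv = record
  { nonNeg   = λ v → nonNeg f-inv (u · v)
  ; ≤1       = λ v → ≤1 f-inv (u · v)
  ; respects = λ e → respects f-inv (~-app ~-refl e)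
  }

invariant-· : ∀ {p f} u → Invariant p f → Invariant p (λ v → f (v · u))
invariant-· u f-inv = record
  { nonNeg   = λ v → nonNeg f-inv (v · u)
  ; ≤1       = λ v → ≤1 f-inv (v · u)
  ; respects = λ e → respects f-inv (~-app e ~-refl)
  }

mean-hidden : ∀ {p f} → Invariant p f → ∀ n → mean n (λ v → f (p · v)) ≡ f (p · K)
mean-hidden {p} {f} f-inv n = trans (mean-cong n (λ v → respects f-inv ~-hide)) (mean-const n (f (p · K)))

mean-nonNeg : ∀ {p f} → Invariant p f → ∀ n → 0ℚ ≤ mean n f
mean-nonNeg f-inv n = subst (_≤ mean n _) (mean-const n 0ℚ) (mean-mono n (nonNeg f-inv))

mean≤1 : ∀ {p f} → Invariant p f → ∀ n → mean n f ≤ 1ℚ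
mean≤1 f-inv n = subst (mean n _ ≤_) (mean-const n 1ℚ) (mean-mono n (≤1 f-inv))

-- The inequality is one-sided because `m` and `n` may be exchanged.
OscillatesFrom : (ℕ → ℚ) → ℚ → ℕ → Set
OscillatesFrom a e N = ∀ m n → N ℕ.≤ m → N ℕ.≤ n → a m ≤ a n + e

Oscillates : (ℕ → ℚ) → ℚ → Set
Oscillates a e = ∃ (OscillatesFrom a e)

common-bound : ∀ {Q : A → ℕ → Set} → (∀ {x m n} → m ℕ.≤ n → Q x m → Q x n) → (∀ x → ∃ (Q x)) →
               ∀ xs → ∃[ N ] (∀ x → x ∈ xs → Q x N)
common-bound mono ex []       = 0 , λ _ ()
common-bound {Q = Q} mono ex (x ∷ xs) with ex x | common-bound {Q = Q} mono ex xs
... | N , q | N′ , qs = N ℕ.⊔ N′ , λ where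
  _ (here refl) → mono (ℕ.m≤m⊔n N N′) q
  y (there y∈)  → mono (ℕ.m≤n⊔m N N′) (qs y y∈)

-- With `e₁ = e + δ`, the slices contribute at most `e₁`, less `e₁ * ω p` for the constant slice at
-- `p`. The upper estimate of the mean adds a deficit of at most `δ`, and the lower estimate adds no
-- error. By `gain` the result is at most `e₁ + δ - 2δ = e`.
oscillation-step : ∀ {p e δ} → 0ℚ < δ → 0ℚ ≤ e + δ → δ + δ ≤ (e + δ) * ω p →
                   (∀ f → Invariant p f → Oscillates (λ n → mean n f) (e + δ)) →
                   ∀ f → Invariant p f → Oscillates (λ n → mean n f) e
-- Beyond `N + 2M`, removing a small factor leaves size at least `N`; the successor accounts for the
-- application at the root.
oscillation-step {p} {e} {δ} 0<δ 0≤e₁ gain hyp f f-inv = suc (N ℕ.+ (M ℕ.+ M)) , oscillation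
  where
  open ≤-Reasoning
  e₁ = e + δ
  M = proj₁ (deficit-small 0<δ (size p))
  p<M = proj₁ (proj₂ (deficit-small 0<δ (size p)))
  d≤δ = proj₂ (proj₂ (deficit-small 0<δ (size p)))

  L R : ℕ → Term → ℚ
  L n u = mean n (λ v → f (u · v))
  R n u = mean n (λ v → f (v · u))

  Close : Term → ℕ → Set
  Close u N = OscillatesFrom (λ n → L n u) e₁ N × OscillatesFrom (λ n → R n u) e₁ N

  close-mono : ∀ {u m n} → m ℕ.≤ n → Close u m → Close u n
  close-mono le (l , r) = (λ i j i≥ j≥ → l i j (ℕ.≤-trans le i≥) (ℕ.≤-trans le j≥)) ,
                          (λ i j i≥ j≥ → r i j (ℕ.≤-trans le i≥) (ℕ.≤-trans le j≥))

  close : ∀ u → ∃ (Close u)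
  close u with hyp _ (·-invariant u f-inv) | hyp _ (invariant-· u f-inv)
  ... | m , l | n , r = m ℕ.⊔ n ,
    (λ i j i≥ j≥ → l i j (ℕ.≤-trans (ℕ.m≤m⊔n m n) i≥) (ℕ.≤-trans (ℕ.m≤m⊔n m n) j≥)) ,
    (λ i j i≥ j≥ → r i j (ℕ.≤-trans (ℕ.m≤n⊔m m n) i≥) (ℕ.≤-trans (ℕ.m≤n⊔m m n) j≥))

  N = proj₁ (common-bound {Q = Close} close-mono close (small M))
  close-small = proj₂ (common-bound {Q = Close} close-mono close (small M))

  module _ (m n : ℕ) (N≤m : N ℕ.+ (M ℕ.+ M) ℕ.≤ m) (N≤n : N ℕ.+ (M ℕ.+ M) ℕ.≤ n) where

    target : Term → ℚ
    target u = ω u * sides n f u + e₁ * (ω u * (1ℚ + 1ℚ))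

    N≤∸ : ∀ {u k} → N ℕ.+ (M ℕ.+ M) ℕ.≤ k → u ∈ small M → N ℕ.≤ k ∸ size u
    N≤∸ {u} {k} le u∈ = ℕ.m+n≤o⇒m≤o∸n N (ℕ.≤-trans
      (ℕ.+-monoʳ-≤ N (ℕ.≤-trans (ℕ.<⇒≤ (∈-small⁻ M u∈)) (ℕ.m≤m+n M M))) le)

    left-close : ∀ u → u ∈ small M → L (m ∸ size u) u ≤ L (n ∸ size u) u + e₁
    left-close u u∈ = proj₁ (close-small u u∈) _ _ (N≤∸ N≤m u∈) (N≤∸ N≤n u∈)

    right-close : ∀ u → u ∈ small M → R (m ∸ size u) u ≤ R (n ∸ size u) u + e₁
    right-close u u∈ = proj₂ (close-small u u∈) _ _ (N≤∸ N≤m u∈) (N≤∸ N≤n u∈)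

    pointwise : ∀ u → u ∈ small M → ω u * sides m f u ≤ target u
    pointwise u u∈ = begin
      ω u * sides m f u ≤⟨ *-monoˡ (ω-nonNeg u) (+-mono-≤ (left-close u u∈) (right-close u u∈)) ⟩
      ω u * (L (n ∸ size u) u + e₁ + (R (n ∸ size u) u + e₁))
        ≡⟨ solve 4 (λ w l r e → w :* (l :+ e :+ (r :+ e)) := w :* (l :+ r) :+ e :* (w :* (con 1ℚ :+ con 1ℚ))) refl
             (ω u) (L (n ∸ size u) u) (R (n ∸ size u) u) e₁ ⟩
      target u ∎

    p∈ : p ∈ small M
    p∈ = ∈-small⁺ p p<M

    -- The left factor p hides its argument, so this summand oscillates by e₁ * ω p less than the others may.
    gap : ω p * sides m f p + e₁ * ω p ≤ target p
    gap = begin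
      ω p * (L (m ∸ size p) p + R (m ∸ size p) p) + e₁ * ω p
        ≤⟨ +-monoˡ-≤ (e₁ * ω p) (*-monoˡ (ω-nonNeg p) (+-mono-≤
             (≤-reflexive (trans (mean-hidden f-inv (m ∸ size p)) (sym (mean-hidden f-inv (n ∸ size p)))))
             (right-close p p∈))) ⟩
      ω p * (L (n ∸ size p) p + (R (n ∸ size p) p + e₁)) + e₁ * ω p
        ≡⟨ solve 4 (λ w l r e → w :* (l :+ (r :+ e)) :+ e :* w := w :* (l :+ r) :+ e :* (w :* (con 1ℚ :+ con 1ℚ))) refl
             (ω p) (L (n ∸ size p) p) (R (n ∸ size p) p) e₁ ⟩
      target p ∎

    weighted-close : weighted M m f + e₁ * ω p ≤ weighted M n f + e₁ * mass M
    weighted-close = subst (weighted M m f + e₁ * ω p ≤_)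
      (trans (Σ-+ (small M) (λ u → ω u * sides n f u) (λ u → e₁ * (ω u * (1ℚ + 1ℚ))))
             (cong (weighted M n f +_) (Σ-*ˡ (small M) e₁ (λ u → ω u * (1ℚ + 1ℚ)))))
      (Σ-mono-gap (small M) pointwise p∈ gap)

    2M≤ : ∀ {k} → N ℕ.+ (M ℕ.+ M) ℕ.≤ k → M ℕ.+ M ℕ.≤ k
    2M≤ = ℕ.≤-trans (ℕ.m≤n+m (M ℕ.+ M) N)

    mass≤1 : mass M ≤ 1ℚ
    mass≤1 = subst (mass M ≤_) (mass+deficit M) (p≤p+q (deficit-nonNeg M))

    mean-close : mean (suc m) f ≤ mean (suc n) f + e
    -- The added `mass M` calls up the upper estimate of the mean, and `δ + δ` is exchanged for
    -- `e₁ * ω p`.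
    mean-close = +-cancelʳ-≤ (mass M + (δ + δ)) (begin
      mean (suc m) f + (mass M + (δ + δ))
        ≤⟨ +-monoʳ-≤ (mean (suc m) f) (+-monoʳ-≤ (mass M) gain) ⟩
      mean (suc m) f + (mass M + e₁ * ω p)
        ≡⟨ sym (+-assoc (mean (suc m) f) (mass M) (e₁ * ω p)) ⟩
      mean (suc m) f + mass M + e₁ * ω p
        ≤⟨ +-monoˡ-≤ (e₁ * ω p) (mean≤weighted (≤1 f-inv) M m (2M≤ N≤m)) ⟩
      1ℚ + weighted M m f + e₁ * ω p
        ≡⟨ +-assoc 1ℚ (weighted M m f) (e₁ * ω p) ⟩
      1ℚ + (weighted M m f + e₁ * ω p)
        ≤⟨ +-monoʳ-≤ 1ℚ weighted-close ⟩
      1ℚ + (weighted M n f + e₁ * mass M)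
        ≤⟨ +-mono-≤ (≤-reflexive (sym (mass+deficit M)))
             (+-mono-≤ (weighted≤mean (nonNeg f-inv) M n (2M≤ N≤n)) (*-monoˡ 0≤e₁ mass≤1)) ⟩
      mass M + deficit M + (mean (suc n) f + e₁ * 1ℚ)
        ≤⟨ +-monoˡ-≤ (mean (suc n) f + e₁ * 1ℚ) (+-monoʳ-≤ (mass M) d≤δ) ⟩
      mass M + δ + (mean (suc n) f + e₁ * 1ℚ)
        ≡⟨ solve 4 (λ s d a e → s :+ d :+ (a :+ (e :+ d) :* con 1ℚ) := a :+ e :+ (s :+ (d :+ d))) refl
             (mass M) δ (mean (suc n) f) e ⟩
      mean (suc n) f + e + (mass M + (δ + δ)) ∎)

  oscillation : OscillatesFrom (λ n → mean n f) e (suc (N ℕ.+ (M ℕ.+ M)))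
  oscillation (suc m) (suc n) (s≤s N≤m) (s≤s N≤n) = mean-close m n N≤m N≤n

-- As long as e stays above ε, a step lowers it by at least the fixed amount δ.
oscillation-descent : ∀ {p ε δ} → 0ℚ < δ → 0ℚ ≤ ε → δ + δ ≤ ε * ω p →
                      ∀ i e → ε ≤ e → 1ℚ ≤ e + ι i * δ →
                      ∀ f → Invariant p f → Oscillates (λ n → mean n f) e
-- Here `e ≥ 1`, and all means lie between 0 and 1.
oscillation-descent {δ = δ} 0<δ 0≤ε gain zero e ε≤e 1≤ f f-inv = 0 , λ m n _ _ → begin
  mean m f         ≤⟨ mean≤1 f-inv m ⟩
  1ℚ               ≤⟨ 1≤ ⟩
  e + 0ℚ * δ       ≡⟨ solve 2 (λ e d → e :+ con 0ℚ :* d := con 0ℚ :+ e) refl e δ ⟩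
  0ℚ + e           ≤⟨ +-monoˡ-≤ e (mean-nonNeg f-inv n) ⟩
  mean n f + e     ∎
  where open ≤-Reasoning
oscillation-descent {p} {ε} {δ} 0<δ 0≤ε gain (suc i) e ε≤e 1≤ =
  oscillation-step 0<δ (≤-trans 0≤ε ε≤e+δ) (≤-trans gain (*-monoʳ (ω-nonNeg p) ε≤e+δ))
    (oscillation-descent 0<δ 0≤ε gain i (e + δ) ε≤e+δ (subst (1ℚ ≤_)
      (solve 3 (λ e d x → e :+ (con 1ℚ :+ x) :* d := e :+ d :+ x :* d) refl e δ (ι i)) 1≤))
  where
  ε≤e+δ : ε ≤ e + δ
  ε≤e+δ = ≤-trans ε≤e (p≤p+q (<⇒≤ 0<δ))

mean-oscillates : ∀ {p f} → Invariant p f → ∀ {ε} → 0ℚ < ε → Oscillates (λ n → mean n f) ε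
mean-oscillates {p} {f} f-inv {ε} 0<ε = oscillation-descent 0<δ (<⇒≤ 0<ε)
  (≤-reflexive (solve 1 (λ x → con ½ :* x :+ con ½ :* x := x) refl (ε * ω p)))
  i ε ≤-refl (≤-trans 1≤iδ (subst (ι i * δ ≤_) (+-comm (ι i * δ) ε) (p≤p+q (<⇒≤ 0<ε)))) f f-inv
  where
  -- The largest `δ` that satisfies the gain condition at `ε`.
  δ = ½ * (ε * ω p)
  εω-pos = pos*pos⇒pos ε {{positive 0<ε}} (ω p) {{positive (8^-pos (suc (size p)))}}
  0<δ : 0ℚ < δ
  0<δ = positive⁻¹ δ {{pos*pos⇒pos ½ (ε * ω p) {{εω-pos}}}}
  i = proj₁ (archimedean 0<δ)
  1≤iδ = proj₂ (archimedean 0<δ)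

-- Limits and densities

2^-pos : ∀ j → 0ℚ < 2^- j
2^-pos j = 1/n-pos (2 ℕ.^ j)
  where instance _ = ℕ.m^n≢0 2 j

-- The oscillation bounds supply the modulus: the j-th approximation is the sequence at the index
-- found for `2^- j`. Regularity then also gives the last component.
limit : ∀ {a} → (∀ j → Oscillates a (2^- j)) →
        Σ[ x ∈ ℝ ] (a ConvergesTo x × (∀ j → ∣ ℝ.approx x j - x ∣≤ 2^- j))
limit {a} osc = x , (λ j → N j , λ n N≤n k → close j k n (N k) N≤n ℕ.≤-refl) , ℝ.regular x
  where
  N : ℕ → ℕ
  N j = proj₁ (osc j)

  below : ∀ j k m n → N j ℕ.≤ m → N k ℕ.≤ n → a m ≤ a n + (2^- j + 2^- k)
  below j k m n m≥ n≥ = begin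
    -- Both terms are compared with the one at the later index `m ⊔ n`.
    a m                     ≤⟨ proj₂ (osc j) m (m ℕ.⊔ n) m≥ (ℕ.≤-trans m≥ (ℕ.m≤m⊔n m n)) ⟩
    a (m ℕ.⊔ n) + 2^- j     ≤⟨ +-monoˡ-≤ (2^- j) (proj₂ (osc k) (m ℕ.⊔ n) n (ℕ.≤-trans n≥ (ℕ.m≤n⊔m m n)) n≥) ⟩
    a n + 2^- k + 2^- j     ≡⟨ trans (+-assoc (a n) (2^- k) (2^- j)) (cong (a n +_) (+-comm (2^- k) (2^- j))) ⟩
    a n + (2^- j + 2^- k)   ∎
    where open ≤-Reasoning

  close : ∀ j k m n → N j ℕ.≤ m → N k ℕ.≤ n → ∣ a m - a n ∣ ≤ 2^- j + 2^- k
  close j k m n m≥ n≥ = ∣p-q∣≤ (below j k m n m≥ n≥)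
    (subst (λ e → a n ≤ a m + e) (+-comm (2^- k) (2^- j)) (below k j n m n≥ m≥))

  x : ℝ
  x = record { approx  = λ j → a (N j)
             ; regular = λ j k → close j k (N j) (N k) ℕ.≤-refl ℕ.≤-refl }

indicator : {P : Pred A 0ℓ} → Decidable P → A → ℚ
indicator P? x = if does (P? x) then 1ℚ else 0ℚ

Σ-indicator : ∀ {P : Pred A 0ℓ} (P? : Decidable P) xs → Σ xs (indicator P?) ≡ ι (length (filter P? xs))
Σ-indicator P? []       = refl
Σ-indicator P? (x ∷ xs) with does (P? x)
... | true  = cong (1ℚ +_) (Σ-indicator P? xs)
... | false = trans (+-identityˡ (Σ xs (indicator P?))) (Σ-indicator P? xs)

proportion≡mean : ∀ {P : Pred Term 0ℓ} (P? : Decidable P) n → proportion P? n ≡ mean n (indicator P?)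
proportion≡mean P? n = trans (/-ι (length (filter P? (combinators n))) (length (combinators n)))
  (cong (_* inv n) (sym (Σ-indicator P? (combinators n))))
  where instance _ = combinators-nonZero n

indicator-invariant : ∀ {p} {P : Pred Term 0ℓ} (P? : Decidable P) →
                      (∀ {t u} → t ~[ p ] u → P t → P u) → Invariant p (indicator P?)
indicator-invariant {p} {P} P? P-resp = record { nonNeg = nonNeg′ ; ≤1 = ≤1′ ; respects = respects′ }
  where
  nonNeg′ : ∀ t → 0ℚ ≤ indicator P? t
  nonNeg′ t with does (P? t)
  ... | true  = 0≤1
  ... | false = ≤-refl
  ≤1′ : ∀ t → indicator P? t ≤ 1ℚ
  ≤1′ t with does (P? t)
  ... | true  = ≤-refl
  ... | false = 0≤1
  respects′ : ∀ {t u} → t ~[ p ] u → indicator P? t ≡ indicator P? u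
  respects′ {t} {u} e with P? t | P? u
  ... | yes _  | yes _  = refl
  ... | no _   | no _   = refl
  ... | yes pt | no ¬pu = ⊥-elim (¬pu (P-resp e pt))
  ... | no ¬pt | yes pu = ⊥-elim (¬pt (P-resp (~-sym e) pu))

density : ∀ {p} {P : Pred Term 0ℓ} (P? : Decidable P) → (∀ {t u} → t ~[ p ] u → P t → P u) →
          Σ[ x ∈ ℝ ] (HasDensity P? x × (∀ j → ∣ ℝ.approx x j - x ∣≤ 2^- j))
density P? P-resp = limit λ j →
  let N , osc = mean-oscillates (indicator-invariant P? P-resp) (2^-pos j)
  in N , λ m n m≥ n≥ → subst₂ (λ x y → x ≤ y + 2^- j)
       (sym (proportion≡mean P? m)) (sym (proportion≡mean P? n)) (osc m n m≥ n≥)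

corollary29 : Σ[ alg ∈ (ℕ → ℕ → ℚ) ]
    (∀ m → Σ[ μ ∈ ℝ ]
    (HasDensity (normalisesIn? m) μ × (∀ j → ∣ alg m j - μ ∣≤ 2^- j)))
corollary29 = (λ m → ℝ.approx (proj₁ (μ m))) , λ m → proj₁ (μ m) , proj₂ (μ m)
  where
  μ : ∀ m → Σ[ x ∈ ℝ ] (HasDensity (normalisesIn? m) x × (∀ j → ∣ ℝ.approx x j - x ∣≤ 2^- j))
  -- Here `p` is inferred to be `delay (suc m)`.
  μ m = density (normalisesIn? m) (λ e → normalisesIn-resp-≈ (~⇒≈ e))
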